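{- Let $(\mathcal{P},f,\mathcal{I})$ be a certified module. Then each fair $\omega$-trace of $(\mathcal{P},f,\mathcal{I})$, i.e. each fair $\omega$-trace of the module $\mathcal{P}$, is terminating.
   Context: **Statements, valuations, traces.** Fix a finite set $\Sigma$ of program statements and program variables $\vec{\mathsf{v}}$. A *valuation* $\nu$ is a function mapping the program variables to values. Each statement $st\in\Sigma$ comes with a binary relation on the set of valuations, its transition relation. An *$\omega$-trace* is an arbitrary infinite sequence $\pi=st_1st_2\ldots$ of statements from $\Sigma$. An $\omega$-trace is *terminating* if it has no infinite execution, i.e. there is no infinite sequence of valuations $\nu_0,\nu_1,\ldots$ with $(\nu_i,\nu_{i+1})$ in the transition relation of $st_{i+1}$ for all $i\ge 0$ (either because some finite prefix has no execution, or because every finite prefix is executable but no starting valuation admits an infinite execution). **Program.** A *program* is a graph $\langle \mathsf{Loc},\delta,\ell_{\mathsf{init}}\rangle$ with a finite set $\mathsf{Loc}$ of locations, a set $\delta\subseteq\mathsf{Loc}\times\Sigma\times\mathsf{Loc}$ of labeled edges and an initial location $\ell_{\mathsf{init}}\in\mathsf{Loc}$. **Module.** A *module* is a program together with a distinguished (final) location, $\mathcal{P}=\langle \mathsf{Loc},\delta,\ell_{\mathsf{init}},\ell_{\mathsf{fin}}\rangle$, such that $\mathsf{Loc}$ can be partitioned into two disjoint sets $\mathsf{Loc}_U,\mathsf{Loc}_V$ with $\ell_{\mathsf{init}}\in\mathsf{Loc}_U$, $\ell_{\mathsf{fin}}\in\mathsf{Loc}_V$, and no location in $\mathsf{Loc}_V$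 has a successor in $\mathsf{Loc}_U$ (i.e. $(\ell,st,\ell')\in\delta$ implies $\ell\in\mathsf{Loc}_U$ or $\ell'\in\mathsf{Loc}_V$). A *fair $\omega$-trace* of $\mathcal{P}$ is an $\omega$-trace that labels a fair path in the graph of $\mathcal{P}$, i.e. an infinite path starting in $\ell_{\mathsf{init}}$ that visits $\ell_{\mathsf{fin}}$ infinitely often. **Predicates, Hoare triples, auxiliary variable.** Let $(\mathbb{W},\prec)$ be a well-ordered set containing an element $\infty$ that is strictly greater than all other elements of $\mathbb{W}$. Let $\mathtt{oldrnk}$ be an auxiliary variable with values in $\mathbb{W}$ that does not occur in the statements of the program (statements in $\Sigma$ neither depend on it nor modify it). A *predicate* is a set of valuations of the program variables together with $\mathtt{oldrnk}$. The Hoare triple $\{I\}\,st\,\{I'\}$ is *valid* if every valuation reachable from a valuation in $I$ via the transition relation of $st$ lies in $I'$. The statement $\mathtt{oldrnk}:=f(\vec{\mathsf{v}})$ assigns the value of $f$ at the current valuation of the program variables to $\mathtt{oldrnk}$ and leaves the program variables unchanged; ";" is sequential composition. **Certified module.** Given a module $\mathcal{P}=\langle \mathsf{Loc},\delta,\ell_{\mathsf{init}},\ell_{\mathsf{fin}}\rangle$ and a function $f$ from valuations (of the program variables) into $(\mathbb{W},\prec)$, a mapping $\mathcal{I}$ from locations to predicates is a *rank certificate* for $f$ and $\mathcal{P}$ if: 1. $\mathcal{I}(\ell_{\mathsf{init}})\Leftrightarrow \mathtt{oldrnk}=\infty$; 2. $\mathcal{I}(\ell_{\mathsf{fin}})\Rightarrow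 f(\vec{\mathsf{v}})\prec\mathtt{oldrnk}$; 3. $\{\mathcal{I}(\ell)\}\ st\ \{\mathcal{I}(\ell')\}$ is valid for every $(\ell,st,\ell')\in\delta$ with $\ell\ne\ell_{\mathsf{fin}}$; 4. $\{\mathcal{I}(\ell_{\mathsf{fin}})\}\ \mathtt{oldrnk}:=f(\vec{\mathsf{v}});\,st\ \{\mathcal{I}(\ell')\}$ is valid for every $(\ell_{\mathsf{fin}},st,\ell')\in\delta$. The triple $(\mathcal{P},f,\mathcal{I})$ is then called a *certified module*. -}

module Defs where

open import Data.Fin.Base using (Fin)
open import Data.Nat.Base using (ℕ; _≤_)
open import Data.Product.Base using (∃; _×_; _,_)
open import Data.Sum.Base using (_⊎_)
open import Function.Bundles using (_↔_; _⇔_)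
open import Induction.WellFounded using (WellFounded)
open import Level using (Level)
open import Relation.Binary.Construct.Composition using (_;_)
open import Relation.Binary.Core using (Rel)
open import Relation.Binary.PropositionalEquality.Core using (_≡_; _≢_)
open import Relation.Binary.Structures using (IsStrictTotalOrder)
open import Relation.Nullary.Negation.Core using (¬_)
open import Relation.Unary using (Pred; Universal; _∈_; _∪_; _⊥_)

Finite : {a : Level} → Set a → Set a
Finite A = ∃ λ n → A ↔ Fin n

record Language (a : Level) : Set (Level.suc a) where
  field
    Stmt       : Set a
    stmtFinite : Finite Stmt
    Var        : Set a
    Value      : Set a

  Valuation : Set a
  Valuation = Var → Value

  field
    ⟦_⟧ : Stmt → Rel Valuation a

-- Zero-based: for the trace st₁ st₂ …, π i is st_{i+1}.
module _ {a : Level} (L : Language a) where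
  open Language L

  ωTrace : Set a
  ωTrace = ℕ → Stmt

  IsExecution : ωTrace → (ℕ → Valuation) → Set a
  IsExecution π ν = ∀ i → ⟦ π i ⟧ (ν i) (ν (ℕ.suc i))

  Terminating : ωTrace → Set a
  Terminating π = ¬ ∃ λ ν → IsExecution π ν

record Program {a : Level} (L : Language a) : Set (Level.suc a) where
  open Language L
  field
    Loc       : Set a
    locFinite : Finite Loc
    δ         : Pred (Loc × Stmt × Loc) a
    ℓinit     : Loc

record IsModulePartition {a : Level} {L : Language a} (P : Program L)
                         (ℓfin : Program.Loc P)
                         (U V : Pred (Program.Loc P) a) : Set a where
  open Program P
  field
    covers   : Universal (U ∪ V)
    disjoint : U ⊥ V
    init∈U   : ℓinit ∈ U
    fin∈V    : ℓfin ∈ V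
    noReturn : ∀ {ℓ st ℓ′} → (ℓ , st , ℓ′) ∈ δ → ℓ ∈ U ⊎ ℓ′ ∈ V

record Module {a : Level} (L : Language a) : Set (Level.suc a) where
  field
    program   : Program L
    ℓfin      : Program.Loc program
    partition : ∃ λ U → ∃ λ V → IsModulePartition program ℓfin U V

  open Program program public

module _ {a : Level} {L : Language a} (P : Module L) where
  open Module P

  record IsFairPath (π : ωTrace L) (ℓ : ℕ → Loc) : Set a where
    field
      start    : ℓ 0 ≡ ℓinit
      edges    : ∀ i → (ℓ i , π i , ℓ (ℕ.suc i)) ∈ δ
      infOften : ∀ n → ∃ λ m → n ≤ m × ℓ m ≡ ℓfin

  IsFairTrace : ωTrace L → Set a
  IsFairTrace π = ∃ λ ℓ → IsFairPath π ℓ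

record WellOrderWithTop (a : Level) : Set (Level.suc a) where
  infix 4 _≺_
  field
    Carrier            : Set a
    _≺_                : Rel Carrier a
    isStrictTotalOrder : IsStrictTotalOrder _≡_ _≺_
    wellFounded        : WellFounded _≺_
    ∞                  : Carrier
    ≺∞                 : ∀ w → w ≢ ∞ → w ≺ ∞

module _ {a : Level} (L : Language a) (W : WellOrderWithTop a) where
  open Language L
  open WellOrderWithTop W

  -- A valuation of the program variables together with the value of oldrnk.
  State : Set a
  State = Valuation × Carrier

  Predicate : Set (Level.suc a)
  Predicate = Pred State a

  -- Statements neither read nor modify oldrnk.
  exec : Stmt → Rel State a
  exec st (ν , r) (ν′ , r′) = ⟦ st ⟧ ν ν′ × r′ ≡ r

  oldrnk≔ : (Valuation → Carrier) → Rel State a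
  oldrnk≔ f (ν , r) σ′ = σ′ ≡ (ν , f ν)

  Hoare : Predicate → Rel State a → Predicate → Set a
  Hoare I R I′ = ∀ {σ σ′} → σ ∈ I → R σ σ′ → σ′ ∈ I′

  record IsRankCertificate (P : Module L) (f : Valuation → Carrier)
                           (I : Module.Loc P → Predicate) : Set a where
    open Module P
    field
      atInit  : ∀ ν r → (ν , r) ∈ I ℓinit ⇔ r ≡ ∞
      atFin   : ∀ ν r → (ν , r) ∈ I ℓfin → f ν ≺ r
      step    : ∀ {ℓ st ℓ′} → (ℓ , st , ℓ′) ∈ δ → ℓ ≢ ℓfin →
                Hoare (I ℓ) (exec st) (I ℓ′)
      stepFin : ∀ {st ℓ′} → (ℓfin , st , ℓ′) ∈ δ →
                Hoare (I ℓfin) (oldrnk≔ f ; exec st) (I ℓ′)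

  record CertifiedModule : Set (Level.suc a) where
    field
      𝒫           : Module L
      f           : Valuation → Carrier
      ℐ           : Module.Loc 𝒫 → Predicate
      certificate : IsRankCertificate 𝒫 f ℐ

{-# OPTIONS --safe #-}
module Submission where

-- Suppose a fair trace had an infinite execution ν₀, ν₁, … along its fair path
-- ℓ₀, ℓ₁, ….  The rank certificate lets one run the auxiliary variable oldrnk
-- alongside: it is ∞ at the start, is left alone at locations other than the
-- final one, and is set to f (ν j) on leaving the final location
-- at time j, so that the state at every time satisfies the predicate of its
-- location.  At each visit the predicate of the final location says that the
-- new value of oldrnk is strictly below the old one.  By fairness there is
-- always a next visit (`nextVisit`), so oldrnk would decrease infinitely often,
-- against well-foundedness (`noState`, by induction on the value of oldrnk).

open import Level using (Level)
open import Data.Fin.Properties using (inj⇒≟)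
open import Data.Nat.Base using (ℕ; suc; _≤‴_; ≤‴-refl; ≤‴-step)
open import Data.Nat.Properties using (≤⇒≤‴)
open import Data.Product.Base using (∃; _×_; _,_)
open import Function.Bundles using (Equivalence)
open import Function.Properties.Inverse using (↔⇒↣)
open import Induction.WellFounded using (Acc; acc)
open import Relation.Binary.Definitions using (DecidableEquality)
open import Relation.Binary.PropositionalEquality.Core using (_≡_; refl; subst; sym)
open import Relation.Nullary.Decidable.Core using (yes; no)
open import Relation.Nullary.Negation.Core using (¬_)
open import Relation.Unary using (_∈_)
open import Defs

Finite⇒≟ : {a : Level} {A : Set a} → Finite A → DecidableEquality A
Finite⇒≟ (_ , A↔Fin) = inj⇒≟ (↔⇒↣ A↔Fin)

module _ {a : Level} (L : Language a) (W : WellOrderWithTop a)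
         (C : CertifiedModule L W) where
  open Language L
  open WellOrderWithTop W
  open CertifiedModule C
  open Module 𝒫
  open IsRankCertificate certificate

  module _ {π : ωTrace L} {ℓ : ℕ → Loc} (fair : IsFairPath 𝒫 π ℓ)
           {ν : ℕ → Valuation} (run : IsExecution L π ν) where
    open IsFairPath fair

    -- At time i of the run, the state with oldrnk = r satisfies the predicate
    -- attached to the current location.
    Holds : ℕ → Carrier → Set a
    Holds i r = (ν i , r) ∈ ℐ (ℓ i)

    -- If the path is at the final location at time m, then from any
    -- time i ≤ m the predicate propagates, with oldrnk unchanged, to the first
    -- visit at or after i.
    nextVisit : ∀ {i m r} → i ≤‴ m → ℓ m ≡ ℓfin → Holds i r →
                ∃ λ j → ℓ j ≡ ℓfin × Holds j r
    nextVisit ≤‴-refl ℓm≡fin h = _ , ℓm≡fin , h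
    nextVisit {i} (≤‴-step i<m) ℓm≡fin h with Finite⇒≟ locFinite (ℓ i) ℓfin
    ... | yes ℓi≡fin = i , ℓi≡fin , h
    ... | no  ℓi≢fin =
      nextVisit i<m ℓm≡fin (step (edges i) ℓi≢fin h (run i , refl))

    decreaseAtVisit : ∀ {j r} → ℓ j ≡ ℓfin → Holds j r → f (ν j) ≺ r
    decreaseAtVisit {j} {r} ℓj≡fin h =
      atFin (ν j) r (subst (λ l → (ν j , r) ∈ ℐ l) ℓj≡fin h)

    updateAfterVisit : ∀ {j r} → ℓ j ≡ ℓfin → Holds j r →
                       Holds (suc j) (f (ν j))
    updateAfterVisit {j} {r} ℓj≡fin h =
      stepFin (subst (λ l → δ (l , π j , ℓ (suc j))) ℓj≡fin (edges j))
              (subst (λ l → (ν j , r) ∈ ℐ l) ℓj≡fin h)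
              ((ν j , f (ν j)) , refl , run j , refl)

    noState : ∀ {i r} → Acc _≺_ r → ¬ Holds i r
    noState {i} (acc rec) h =
      let m , i≤m , ℓm≡fin = infOften i
          j , ℓj≡fin , hj  = nextVisit (≤⇒≤‴ i≤m) ℓm≡fin h
      in noState (rec (decreaseAtVisit ℓj≡fin hj)) (updateAfterVisit ℓj≡fin hj)

    initially : Holds 0 ∞
    initially = subst (λ l → (ν 0 , ∞) ∈ ℐ l) (sym start)
                      (Equivalence.from (atInit (ν 0) ∞) refl)

theorem1 : {a : Level} (L : Language a) (W : WellOrderWithTop a)
    (C : CertifiedModule L W) (π : ωTrace L) →
    IsFairTrace (CertifiedModule.𝒫 C) π → Terminating L π
theorem1 L W C π (ℓ , fair) (ν , run) =
  noState L W C fair run (WellOrderWithTop.wellFounded W _)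
          (initially L W C fair run)
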